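{- Let $A$ be a sub-Hilbert algebra, and let $D$ be the complete sublattice of $\mathrm{IFil}(A)^+$ generated by $j(\square A)$. Then the pair $(\mathrm{IFil}(A)^+,D)$ is a subresiduated lattice in which $j(A)$ is (the universe of) a subalgebra of the implicative reduct that is isomorphic to $A$.
   Context: A sub-Hilbert algebra is an algebra $(A,\to,1)$ of type $(2,0)$ satisfying, for all $x,y,z\in A$: (B) $(x\to y)\to((y\to z)\to(x\to z))=1$; (I) $x\to x=1$; (T) $x\to 1=1$; (A) if $x\to y=1$ and $y\to x=1$ then $x=y$; (S) $(x\to(y\to z))\to((x\to y)\to(x\to z))=1$. Put $\square a:=1\to a$ and $\square A:=\{\square a: a\in A\}$. An implicative filter of $A$ is a subset $F\subseteq A$ such that $1\in F$, and for all $a,b\in A$, if $a\in F$ and $a\to b\in F$ then $b\in F$. $\mathrm{IFil}(A)$ is the set of implicative filters of $A$, ordered by inclusion. For a poset $X$, $X^+$ is the complete lattice of upsets of $X$ (ordered by inclusion, with unions and intersections as joins and meets). The map $j:A\to\mathrm{IFil}(A)^+$ is $j(a):=\{F\in\mathrm{IFil}(A): a\in F\}$. Complete sublattices are closed under arbitrary (including empty) joins and meets. A pair $(L,D)$ is a subresiduated lattice if $L$ is a bounded distributive lattice, $D$ is a bounded sublattice of $L$ (with the same $0$ and $1$), and for all $a,b\in L$ the set $\{d\in D: d\wedge a\le b\}$ has a maximum; its implication is $a\Rightarrow b:=\max\{d\in D: d\wedge a\le b\}$. The implicative reduct of $(L,D)$ is $(L,\Rightarrow,1)$. -}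

module Defs where

open import Algebra.Bundles.Raw using (RawMonoid)
open import Algebra.Core using (Op₂)
open import Algebra.Definitions using (Congruent₂)
open import Algebra.Morphism.Structures using (module MonoidMorphisms)
open import Data.Product using (Σ; ∃; _×_; _,_; proj₁; proj₂)
open import Data.Sum using (inj₁; inj₂)
open import Data.Unit.Polymorphic using (tt)
open import Function using (_on_)
open import Level using (Level; Lift; lift; lower; _⊔_; suc)
open import Relation.Binary using (Rel; Poset; IsEquivalence; _Respects_)
open import Relation.Binary.Lattice
  using (BoundedLattice; IsDistributiveLattice)
open import Relation.Unary using (Pred; _∈_; _⊆_; _≐_; _∪_; _∩_; ⋃; ⋂)
open import Relation.Unary.Polymorphic using (∅; U)

private
  variable
    a b c d g s ℓ ℓ₁ ℓ₂ : Level

-- `RawMonoid` is used purely as the signature of one binary operation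
-- and one constant over a setoid; no monoid law is implied.

module _ (M : RawMonoid c ℓ) where

  open RawMonoid M

  record IsSubuniverse (S : Pred Carrier s) : Set (c ⊔ ℓ ⊔ s) where
    field
      resp     : S Respects _≈_
      ε-closed : ε ∈ S
      ∙-closed : ∀ {x y} → x ∈ S → y ∈ S → (x ∙ y) ∈ S

  subalgebra : (S : Pred Carrier s) → IsSubuniverse S → RawMonoid (c ⊔ s) ℓ
  subalgebra S S-sub = record
    { Carrier = Σ Carrier S
    ; _≈_     = _≈_ on proj₁
    ; _∙_     = λ (x , x∈S) (y , y∈S) → x ∙ y , ∙-closed x∈S y∈S
    ; ε       = ε , ε-closed
    }
    where open IsSubuniverse S-sub

infix 4 _≅_

_≅_ : RawMonoid a ℓ₁ → RawMonoid b ℓ₂ → Set (a ⊔ b ⊔ ℓ₁ ⊔ ℓ₂)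
M ≅ N = ∃ λ f → MonoidMorphisms.IsMonoidIsomorphism M N f

module _ (L : BoundedLattice c ℓ₁ ℓ₂) where

  open BoundedLattice L

  record IsBoundedSublattice (D : Pred Carrier d)
                             : Set (c ⊔ ℓ₁ ⊔ d) where
    field
      resp     : D Respects _≈_
      ⊥-closed : ⊥ ∈ D
      ⊤-closed : ⊤ ∈ D
      ∨-closed : ∀ {x y} → x ∈ D → y ∈ D → (x ∨ y) ∈ D
      ∧-closed : ∀ {x y} → x ∈ D → y ∈ D → (x ∧ y) ∈ D

  IsMaximumOf : Pred Carrier s → Pred Carrier (c ⊔ ℓ₂ ⊔ s)
  IsMaximumOf S m = m ∈ S × (∀ {x} → x ∈ S → x ≤ m)

  record IsSubresiduatedLattice (D : Pred Carrier d)
                                : Set (c ⊔ ℓ₁ ⊔ ℓ₂ ⊔ d) where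
    field
      isDistributiveLattice : IsDistributiveLattice _≈_ _≤_ _∨_ _∧_
      isBoundedSublattice   : IsBoundedSublattice D
      maximum-exists        : ∀ x y →
        ∃ λ m → IsMaximumOf (λ z → z ∈ D × (z ∧ x) ≤ y) m

    infixr 5 _⇒_

    _⇒_ : Op₂ Carrier
    x ⇒ y = proj₁ (maximum-exists x y)

    implicativeReduct : RawMonoid c ℓ₁
    implicativeReduct = record { _≈_ = _≈_ ; _∙_ = _⇒_ ; ε = ⊤ }

-- Upsets of `X` are predicates in a universe `Set (upsetLevel X)` large
-- enough to hold `X` itself, and joins and meets are taken of families
-- indexed by arbitrary types of that universe.  Classically this covers
-- every set of upsets: choosing one member per point in the union (or
-- per point outside the intersection) gives a subfamily indexed by a
-- subset of `X` with the same union (intersection).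

upsetLevel : Poset c ℓ₁ ℓ₂ → Level
upsetLevel {c} {ℓ₁} {ℓ₂} _ = c ⊔ ℓ₁ ⊔ ℓ₂

module Upsets (X : Poset c ℓ₁ ℓ₂) where

  open Poset X using (Carrier; _≤_)

  private
    u : Level
    u = upsetLevel X

  record Upset : Set (suc u) where
    constructor mkUpset
    field
      ⟦_⟧    : Pred Carrier u
      upward : ⟦_⟧ Respects _≤_

  open Upset public

  infix 4 _≈⁺_ _≤⁺_

  _≈⁺_ : Rel Upset u
  V ≈⁺ W = ⟦ V ⟧ ≐ ⟦ W ⟧

  _≤⁺_ : Rel Upset u
  V ≤⁺ W = ⟦ V ⟧ ⊆ ⟦ W ⟧

  ⋁ : {I : Set u} → (I → Upset) → Upset
  ⋁ {I} V = mkUpset (⋃ I (λ i → ⟦ V i ⟧))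
                    (λ x≤y (i , x∈Vi) → i , upward (V i) x≤y x∈Vi)

  ⋀ : {I : Set u} → (I → Upset) → Upset
  ⋀ {I} V = mkUpset (⋂ I (λ i → ⟦ V i ⟧))
                    (λ x≤y x∈V i → upward (V i) x≤y (x∈V i))

  upsetLattice : BoundedLattice (suc u) u u
  upsetLattice = record
    { Carrier = Upset
    ; _≈_     = _≈⁺_
    ; _≤_     = _≤⁺_
    ; _∨_     = λ V W → mkUpset (⟦ V ⟧ ∪ ⟦ W ⟧) λ where
        x≤y (inj₁ x∈V) → inj₁ (upward V x≤y x∈V)
        x≤y (inj₂ x∈W) → inj₂ (upward W x≤y x∈W)
    ; _∧_     = λ V W → mkUpset (⟦ V ⟧ ∩ ⟦ W ⟧)
        λ x≤y (x∈V , x∈W) → upward V x≤y x∈V , upward W x≤y x∈W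
    ; ⊤       = mkUpset U (λ _ _ → tt)
    ; ⊥       = mkUpset ∅ (λ _ ())
    ; isBoundedLattice = record
      { isLattice = record
        { isPartialOrder = record
          { isPreorder = record
            { isEquivalence = record
              { refl  = (λ p → p) , (λ p → p)
              ; sym   = λ (f , f⁻¹) → f⁻¹ , f
              ; trans = λ (f , f⁻¹) (g , g⁻¹) →
                  (λ p → g (f p)) , (λ p → f⁻¹ (g⁻¹ p))
              }
            ; reflexive = proj₁
            ; trans     = λ f g p → g (f p)
            }
          ; antisym = _,_
          }
        ; supremum = λ _ _ → inj₁ , inj₂ ,
            λ _ f g → λ { (inj₁ p) → f p ; (inj₂ q) → g q }
        ; infimum  = λ _ _ → proj₁ , proj₂ , λ _ f g p → f p , g p
        }
      ; maximum = λ _ _ → tt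
      ; minimum = λ _ ()
      }
    }

  record IsCompleteSublattice (S : Pred Upset s) : Set (suc u ⊔ s) where
    field
      resp     : S Respects _≈⁺_
      ⋁-closed : {I : Set u} {V : I → Upset} → (∀ i → V i ∈ S) → ⋁ V ∈ S
      ⋀-closed : {I : Set u} {V : I → Upset} → (∀ i → V i ∈ S) → ⋀ V ∈ S

  data Generated (G : Pred Upset g) : Pred Upset (suc u ⊔ g) where
    gen      : ∀ {V} → V ∈ G → Generated G V
    resp     : ∀ {V W} → V ≈⁺ W → Generated G V → Generated G W
    ⋁-closed : {I : Set u} {V : I → Upset} →
               (∀ i → Generated G (V i)) → Generated G (⋁ V)
    ⋀-closed : {I : Set u} {V : I → Upset} →
               (∀ i → Generated G (V i)) → Generated G (⋀ V)

  generated-isCompleteSublattice :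
    (G : Pred Upset g) → IsCompleteSublattice (Generated G)
  generated-isCompleteSublattice G =
    record { resp = resp ; ⋁-closed = ⋁-closed ; ⋀-closed = ⋀-closed }

  generated-least : {G : Pred Upset g} {S : Pred Upset s} →
                    IsCompleteSublattice S → G ⊆ S → Generated G ⊆ S
  generated-least S-sub G⊆S = go
    where
    module S = IsCompleteSublattice S-sub
    go : Generated _ ⊆ _
    go (gen V∈G)     = G⊆S V∈G
    go (resp V≈W p)  = S.resp V≈W (go p)
    go (⋁-closed ps) = S.⋁-closed (λ i → go (ps i))
    go (⋀-closed ps) = S.⋀-closed (λ i → go (ps i))

record SubHilbertAlgebra c ℓ : Set (suc (c ⊔ ℓ)) where
  infix  4 _≈_
  infixr 5 _⇾_
  field
    Carrier       : Set c
    _≈_           : Rel Carrier ℓ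
    _⇾_           : Op₂ Carrier
    𝟙             : Carrier
    isEquivalence : IsEquivalence _≈_
    ⇾-cong        : Congruent₂ _≈_ _⇾_
    axiom-B       : ∀ x y z → (x ⇾ y) ⇾ ((y ⇾ z) ⇾ (x ⇾ z)) ≈ 𝟙
    axiom-I       : ∀ x → x ⇾ x ≈ 𝟙
    axiom-T       : ∀ x → x ⇾ 𝟙 ≈ 𝟙
    axiom-A       : ∀ x y → x ⇾ y ≈ 𝟙 → y ⇾ x ≈ 𝟙 → x ≈ y
    axiom-S       : ∀ x y z →
                    (x ⇾ (y ⇾ z)) ⇾ ((x ⇾ y) ⇾ (x ⇾ z)) ≈ 𝟙

  rawAlgebra : RawMonoid c ℓ
  rawAlgebra = record { _≈_ = _≈_ ; _∙_ = _⇾_ ; ε = 𝟙 }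

  □_ : Carrier → Carrier
  □ x = 𝟙 ⇾ x

  □A : Pred Carrier (c ⊔ ℓ)
  □A x = ∃ λ y → x ≈ □ y

module ImplicativeFilters (A : SubHilbertAlgebra c ℓ) where

  open SubHilbertAlgebra A

  record ImplicativeFilter : Set (suc (c ⊔ ℓ)) where
    field
      member : Pred Carrier (c ⊔ ℓ)
      resp   : member Respects _≈_
      𝟙∈     : 𝟙 ∈ member
      mp     : ∀ {x y} → x ∈ member → (x ⇾ y) ∈ member → y ∈ member

  open ImplicativeFilter using (member)

  IFil : Poset (suc (c ⊔ ℓ)) (c ⊔ ℓ) (c ⊔ ℓ)
  IFil = record
    { Carrier = ImplicativeFilter
    ; _≈_     = λ F G → member F ≐ member G
    ; _≤_     = λ F G → member F ⊆ member G
    ; isPartialOrder = record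
      { isPreorder = record
        { isEquivalence = record
          { refl  = (λ p → p) , (λ p → p)
          ; sym   = λ (f , f⁻¹) → f⁻¹ , f
          ; trans = λ (f , f⁻¹) (g , g⁻¹) →
              (λ p → g (f p)) , (λ p → f⁻¹ (g⁻¹ p))
          }
        ; reflexive = proj₁
        ; trans     = λ f g p → g (f p)
        }
      ; antisym = _,_
      }
    }

  open Upsets IFil public

  j : Carrier → Upset
  j x = mkUpset (λ F → Lift _ (x ∈ member F))
                (λ F⊆G p → lift (F⊆G (lower p)))

  j[_] : Pred Carrier s → Pred Upset (suc (c ⊔ ℓ) ⊔ s)
  j[ S ] V = ∃ λ x → x ∈ S × V ≈⁺ j x

{-# OPTIONS --safe #-}

-- A complete sublattice D of the lattice of upsets of a poset consists of the
-- upsets of the coarser preorder x ≼ y saying that every generator containing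
-- x contains y, so that
--   V ⇒ W = { x : every y with x ≼ y and y ∈ V lies in W }.
-- For implicative filters F ≼ G means that G contains F ∩ □A.  If a ⇾ b ∈ F
-- then □ (a ⇾ b) ∈ F, so □ (a ⇾ b) and hence a ⇾ b lie in G, and b ∈ G as
-- soon as a ∈ G.  Conversely { x : a ⇾ x ∈ F } is an implicative filter that
-- contains a and F ∩ □A; testing membership of F in j a ⇒ j b on it gives
-- a ⇾ b ∈ F.  Hence j a ⇒ j b = j (a ⇾ b).  For F = {𝟙} the same filter is the
-- principal one of a, which shows that j is injective.

module Submission where

open import Defs
open import Data.Product using (Σ-syntax; ∃; _,_; proj₁; proj₂)
open import Data.Sum using (inj₁; inj₂)
open import Data.Unit.Polymorphic using (tt)
open import Level using (Level; Lift; lift; lower)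
open import Relation.Binary using (Rel; Poset; Setoid; IsEquivalence; _Respects_)
open import Relation.Binary.Lattice using (BoundedLattice)
open import Relation.Unary using (Pred; _∈_; U)
import Relation.Binary.Reasoning.Setoid as SetoidReasoning

private
  variable
    c g ℓ ℓ₁ ℓ₂ : Level

-- `G` is a predicate on the larger type of all upsets, so quantifying over its members would leave
-- the universe of upsets. Listing them up to `≈⁺` by a small family `γ` keeps `≼`, and hence `⇛`,
-- at `upsetLevel X`.
module GeneratedUpsets
  (X : Poset c ℓ₁ ℓ₂)
  (G : Pred (Upsets.Upset X) g)
  {I : Set (upsetLevel X)} (γ : I → Upsets.Upset X)
  (γ∈G : ∀ i → γ i ∈ G)
  (G⊆γ : ∀ V → V ∈ G → ∃ λ i → Upsets._≈⁺_ X V (γ i))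
  where

  open Poset X using (Carrier; _≤_)
  open Upsets X

  infix 4 _≼_

  _≼_ : Rel Carrier (upsetLevel X)
  x ≼ y = ∀ i → x ∈ ⟦ γ i ⟧ → y ∈ ⟦ γ i ⟧

  ≤⇒≼ : ∀ {x y} → x ≤ y → x ≼ y
  ≤⇒≼ x≤y i = upward (γ i) x≤y

  ≼-trans : ∀ {x y z} → x ≼ y → y ≼ z → x ≼ z
  ≼-trans x≼y y≼z i p = y≼z i (x≼y i p)

  ≼-upsets-isCompleteSublattice :
    IsCompleteSublattice (λ V → ⟦ V ⟧ Respects _≼_)
  ≼-upsets-isCompleteSublattice = record
    { resp     = λ (V⊆W , W⊆V) up x≼y p → V⊆W (up x≼y (W⊆V p))
    ; ⋁-closed = λ ups x≼y (i , p) → i , ups i x≼y p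
    ; ⋀-closed = λ ups x≼y p i → ups i x≼y (p i)
    }

  generated⇒≼-upset : ∀ {V} → Generated G V → ⟦ V ⟧ Respects _≼_
  generated⇒≼-upset = generated-least ≼-upsets-isCompleteSublattice G-up
    where
    G-up : ∀ {V} → V ∈ G → ⟦ V ⟧ Respects _≼_
    G-up V∈G x≼y p with G⊆γ _ V∈G
    ... | i , V⊆γi , γi⊆V = γi⊆V (x≼y i (V⊆γi p))

  -- The inner meet is the principal ≼-upset of x.
  ≼-upset⇒generated : ∀ {V} → ⟦ V ⟧ Respects _≼_ → Generated G V
  ≼-upset⇒generated {V} up =
    resp ( (λ { ((x , x∈V) , p) → up (λ i q → p (i , q)) x∈V })
         , (λ {x} x∈V → (x , x∈V) , proj₂) )
         (⋁-closed {I = ∃ ⟦ V ⟧} λ (x , _) →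
           ⋀-closed {I = ∃ λ i → x ∈ ⟦ γ i ⟧} λ (i , _) → gen (γ∈G i))

  infixr 5 _⇛_

  _⇛_ : Upset → Upset → Upset
  V ⇛ W = mkUpset (λ x → ∀ {y} → x ≼ y → y ∈ ⟦ V ⟧ → y ∈ ⟦ W ⟧)
                  (λ x≤y p y≼z → p (≼-trans (≤⇒≼ x≤y) y≼z))

  ⇛-cong : ∀ {V V′ W W′} → V ≈⁺ V′ → W ≈⁺ W′ → (V ⇛ W) ≈⁺ (V′ ⇛ W′)
  ⇛-cong (V⊆V′ , V′⊆V) (W⊆W′ , W′⊆W) =
    (λ p x≼y q → W⊆W′ (p x≼y (V′⊆V q))) ,
    (λ p x≼y q → W′⊆W (p x≼y (V⊆V′ q)))

  generated-isSubresiduatedLattice :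
    IsSubresiduatedLattice upsetLattice (Generated G)
  generated-isSubresiduatedLattice = record
    { isDistributiveLattice = record
      { isLattice    = isLattice
      ; ∧-distribˡ-∨ = λ _ _ _ →
          (λ { (p , inj₁ q) → inj₁ (p , q) ; (p , inj₂ r) → inj₂ (p , r) }) ,
          (λ { (inj₁ (p , q)) → p , inj₁ q ; (inj₂ (p , r)) → p , inj₂ r })
      }
    -- The finite operations are not literal instances of `⋁` and `⋀`; closure is read off the
    -- description of `Generated G` by `≼`-upsets.
    ; isBoundedSublattice = record
      { resp     = resp
      ; ⊥-closed = ≼-upset⇒generated λ _ ()
      ; ⊤-closed = ≼-upset⇒generated λ _ _ → tt
      ; ∨-closed = λ V∈D W∈D → ≼-upset⇒generated λ where
          x≼y (inj₁ p) → inj₁ (generated⇒≼-upset V∈D x≼y p)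
          x≼y (inj₂ q) → inj₂ (generated⇒≼-upset W∈D x≼y q)
      ; ∧-closed = λ V∈D W∈D → ≼-upset⇒generated λ x≼y (p , q) →
          generated⇒≼-upset V∈D x≼y p , generated⇒≼-upset W∈D x≼y q
      }
    -- Reflexivity of `≼` gives the bound. For maximality, a competitor `Z` in `D` is a `≼`-upset,
    -- so a point of `Z` takes every `y` above it along into `Z`, where the bound on `Z` applies.
    ; maximum-exists = λ V W → V ⇛ W ,
        ( ≼-upset⇒generated (λ x≼y p y≼z → p (≼-trans x≼y y≼z))
        , (λ (p , q) → p (λ _ r → r) q) ) ,
        λ (Z∈D , Z∧V⊆W) p x≼y q → Z∧V⊆W (generated⇒≼-upset Z∈D x≼y p , q)
    }
    where open BoundedLattice upsetLattice using (isLattice)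

module FilterRepresentation (A : SubHilbertAlgebra c ℓ) where

  open SubHilbertAlgebra A
  open ImplicativeFilters A hiding (resp)
  open ImplicativeFilter
  open IsEquivalence isEquivalence using (refl; sym; trans)

  setoid : Setoid c ℓ
  setoid = record { isEquivalence = isEquivalence }

  open SetoidReasoning setoid

  -- An instance of `axiom-B` in which the middle implication `y ⇾ y` collapses to `𝟙`. It lets a
  -- filter's implications be tested on `□A`.
  ⇾-□ : ∀ x y → (x ⇾ y) ⇾ □ (x ⇾ y) ≈ 𝟙
  ⇾-□ x y = begin
    (x ⇾ y) ⇾ (𝟙 ⇾ (x ⇾ y))       ≈⟨ ⇾-cong refl (⇾-cong (axiom-I y) refl) ⟨
    (x ⇾ y) ⇾ ((y ⇾ y) ⇾ (x ⇾ y)) ≈⟨ axiom-B x y y ⟩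
    𝟙                             ∎

  -- `axiom-B` through the middle element `𝟙`, using `x ⇾ 𝟙 ≈ 𝟙`. The outer box is harmless in a
  -- filter: detachment with `𝟙` removes it.
  □-weaken : ∀ x y → □ (□ y ⇾ (x ⇾ y)) ≈ 𝟙
  □-weaken x y = begin
    𝟙 ⇾ (□ y ⇾ (x ⇾ y))       ≈⟨ ⇾-cong (axiom-T x) refl ⟨
    (x ⇾ 𝟙) ⇾ (□ y ⇾ (x ⇾ y)) ≈⟨ axiom-B x 𝟙 y ⟩
    𝟙                         ∎

  module _ (F : ImplicativeFilter) where

    ≈𝟙⇒∈ : ∀ {x} → x ≈ 𝟙 → x ∈ member F
    ≈𝟙⇒∈ x≈𝟙 = resp F (sym x≈𝟙) (𝟙∈ F)

    ⇾∈⇒□∈ : ∀ {x y} → (x ⇾ y) ∈ member F → □ (x ⇾ y) ∈ member F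
    ⇾∈⇒□∈ {x} {y} p = mp F p (≈𝟙⇒∈ (⇾-□ x y))

    □∈⇒⇾∈ : ∀ {x y} → □ y ∈ member F → (x ⇾ y) ∈ member F
    □∈⇒⇾∈ {x} {y} p = mp F p (mp F (𝟙∈ F) (≈𝟙⇒∈ (□-weaken x y)))

    relativeFilter : Carrier → ImplicativeFilter
    relativeFilter a = record
      { member = λ x → (a ⇾ x) ∈ member F
      ; resp   = λ x≈y → resp F (⇾-cong refl x≈y)
      ; 𝟙∈     = ≈𝟙⇒∈ (axiom-T a)
      ; mp     = λ {x} {y} p q → mp F p (mp F q (≈𝟙⇒∈ (axiom-S a x y)))
      }

    ∈-relativeFilter : ∀ a → a ∈ member (relativeFilter a)
    ∈-relativeFilter a = ≈𝟙⇒∈ (axiom-I a)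

  trivialFilter : ImplicativeFilter
  trivialFilter = record
    { member = λ x → Lift c (x ≈ 𝟙)
    ; resp   = λ x≈y (lift x≈𝟙) → lift (trans (sym x≈y) x≈𝟙)
    ; 𝟙∈     = lift refl
    -- The premises give `𝟙 ⇾ y ≈ 𝟙`; together with `axiom-T`, antisymmetry forces `y ≈ 𝟙`.
    ; mp     = λ {x} {y} (lift x≈𝟙) (lift x⇾y≈𝟙) → lift
        (axiom-A y 𝟙 (axiom-T y) (trans (⇾-cong (sym x≈𝟙) refl) x⇾y≈𝟙))
    }

  j-cong : ∀ {x y} → x ≈ y → j x ≈⁺ j y
  j-cong x≈y = (λ {F} (lift p) → lift (resp F x≈y p)) ,
               (λ {F} (lift p) → lift (resp F (sym x≈y) p))

  j-reflects-≤ : ∀ {x y} → j x ≤⁺ j y → x ⇾ y ≈ 𝟙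
  j-reflects-≤ {x} jx⊆jy =
    lower (lower (jx⊆jy {relativeFilter trivialFilter x}
                        (lift (∈-relativeFilter trivialFilter x))))

  j-injective : ∀ {x y} → j x ≈⁺ j y → x ≈ y
  j-injective {x} {y} (jx⊆jy , jy⊆jx) =
    axiom-A x y (j-reflects-≤ λ {F} → jx⊆jy {F})
                (j-reflects-≤ λ {F} → jy⊆jx {F})

  -- Indexing by all elements, rather than by those of `□A`, lists the generators with repetition;
  -- the `Lift` puts the index type in the universe over which joins and meets range.
  j□ : Lift (upsetLevel IFil) Carrier → Upset
  j□ (lift x) = j (□ x)

  j□∈j[□A] : ∀ x → j□ x ∈ j[ □A ]
  j□∈j[□A] (lift x) = □ x , (x , refl) , (λ p → p) , (λ p → p)

  j[□A]⊆j□ : ∀ V → V ∈ j[ □A ] → ∃ λ x → V ≈⁺ j□ x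
  j[□A]⊆j□ _ (x , (y , x≈□y) , V⊆jx , jx⊆V) = lift y ,
    (λ {F} p → proj₁ (j-cong x≈□y) {F} (V⊆jx p)) ,
    (λ {F} p → jx⊆V (proj₂ (j-cong x≈□y) {F} p))

  open GeneratedUpsets IFil j[ □A ] j□ j□∈j[□A] j[□A]⊆j□ public

  ≼-relativeFilter : ∀ F a → F ≼ relativeFilter F a
  -- A boxed element is itself an implication from `𝟙`, so `F` contains its box as well, and
  -- weakening then prefixes `a`.
  ≼-relativeFilter F a _ (lift p) = lift (□∈⇒⇾∈ F (⇾∈⇒□∈ F p))

  j-⇛ : ∀ x y → (j x ⇛ j y) ≈⁺ j (x ⇾ y)
  j-⇛ x y =
    (λ {F} p → lift (lower (p {relativeFilter F x} (≼-relativeFilter F x)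
                             (lift (∈-relativeFilter F x))))) ,
    -- Only the box of `x ⇾ y` passes from `F` to `G`; the inner `mp` with `𝟙` strips it off again.
    (λ {F} (lift p) {G} F≼G (lift x∈G) → lift
      (mp G x∈G (mp G (𝟙∈ G)
        (lower (F≼G (lift (x ⇾ y)) (lift (⇾∈⇒□∈ F p)))))))

theorem3p23 : ∀ {c ℓ} (A : SubHilbertAlgebra c ℓ) →
    let open SubHilbertAlgebra A
        open ImplicativeFilters A
        D = Generated j[ □A ]
    in Σ[ srl ∈ IsSubresiduatedLattice upsetLattice D ]
       let reduct = IsSubresiduatedLattice.implicativeReduct srl
       in Σ[ sub ∈ IsSubuniverse reduct j[ U ] ]
          (subalgebra reduct j[ U ] sub ≅ rawAlgebra)
-- The isomorphism runs from `j[ U ]` back to `A`, reading off the element stored in the membership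
-- proof. Injectivity of `j` makes it respect equality, while `j-cong` makes it injective. It is a
-- homomorphism by reflexivity, since `sub` stores `x ⇾ y` for the product and `𝟙` for the unit.
theorem3p23 A = srl , sub , (λ (_ , x , _) → x) , record
  { isMonoidMonomorphism = record
    { isMonoidHomomorphism = record
      { isMagmaHomomorphism = record
        { isRelHomomorphism = record { cong = λ {V} {W} → label-cong V W }
        ; homo              = λ _ _ → A.refl
        }
      ; ε-homo = A.refl
      }
    ; injective = λ { {V , x , _ , V≈jx} {W , y , _ , W≈jy} x≈y → begin
        V    ≈⟨ V≈jx ⟩
        j x  ≈⟨ j-cong x≈y ⟩
        j y  ≈⟨ W≈jy ⟨
        W    ∎ }
    }
  ; surjective = λ y → (j y , y , _ , ⁺.refl {j y}) ,
      λ {V} → label-cong V (j y , y , _ , ⁺.refl {j y})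
  }
  where
  open SubHilbertAlgebra A
  open ImplicativeFilters A
  open FilterRepresentation A
  module A = IsEquivalence isEquivalence
  module ⁺ = BoundedLattice.Eq upsetLattice
  open SetoidReasoning (BoundedLattice.setoid upsetLattice)

  srl = generated-isSubresiduatedLattice

  sub : IsSubuniverse (IsSubresiduatedLattice.implicativeReduct srl) j[ U ]
  sub = record
    { resp     = λ { {V} {W} V≈W (x , _ , V≈jx) → x , _ , (begin
        W    ≈⟨ V≈W ⟨
        V    ≈⟨ V≈jx ⟩
        j x  ∎) }
    ; ε-closed = 𝟙 , _ , (λ {F} _ → lift (ImplicativeFilter.𝟙∈ F)) , λ _ → tt
    ; ∙-closed = λ { {V} {W} (x , _ , V≈jx) (y , _ , W≈jy) →
        x ⇾ y , _ , (begin
          V ⇛ W      ≈⟨ ⇛-cong {V} {j x} {W} {j y} V≈jx W≈jy ⟩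
          j x ⇛ j y  ≈⟨ j-⇛ x y ⟩
          j (x ⇾ y)  ∎) }
    }

  label-cong : ((V , x , _) (W , y , _) : ∃ j[ U ]) → V ≈⁺ W → x ≈ y
  label-cong (V , x , _ , V≈jx) (W , y , _ , W≈jy) V≈W = j-injective (begin
    j x  ≈⟨ V≈jx ⟨
    V    ≈⟨ V≈W ⟩
    W    ≈⟨ W≈jy ⟩
    j y  ∎)
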